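{- There exists a function $\varepsilon:\mathbb{Z}_{>0}\to\mathbb{R}$ with $\varepsilon(n) = O(n^{ -3/2})$ as $n\to\infty$ (the implied constant being absolute, in particular independent of $r$) such that for all positive integers $n$ and $r$, \[ \mathsf{s}_{2n}(C_n^r) > \frac{n}{2}\left[\frac{5}{4} - \varepsilon(n)\right]^r . \] Equivalently, there is a sequence of length at least $\frac{n}{2}\left[\frac{5}{4} - \varepsilon(n)\right]^r$ of elements of $C_n^r$ containing no zero-sum subsequence of length $2n$.
   Context: $C_n = \mathbb{Z}/n\mathbb{Z}$ denotes the cyclic group of order $n$, and $C_n^r$ its $r$-fold direct product. For a finite abelian group $G$ with exponent $\exp(G)=n$ (the largest order of an element of $G$) and a positive integer $k$, the generalized Erdős–Ginzburg–Ziv constant $\mathsf{s}_{kn}(G)$ is the smallest integer $m$ such that every sequence (elements may repeat) of $m$ elements of $G$ contains a subsequence of length $kn$ whose terms sum to zero in $G$. Note $\exp(C_n^r)=n$. -}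

module Defs where

open import Data.Nat using (ℕ; zero; suc; _+_; _*_)
open import Data.Nat.Divisibility using (_∣_)
open import Data.Fin using (Fin; toℕ)
import Data.Fin as Fin
open import Data.Product using (Σ; _×_; _,_)
open import Function.Definitions using (Injective)
open import Relation.Binary.PropositionalEquality using (_≡_)
open import Relation.Nullary using (¬_)
open import Data.Rational using (ℚ; 1ℚ)
import Data.Rational as Q
open import Data.Integer using (+_)

finSum : (m : ℕ) → (Fin m → ℕ) → ℕ
finSum zero    f = 0
finSum (suc m) f = f Fin.zero + finSum m (λ i → f (Fin.suc i))

-- Elements of C_n^r: r-tuples of residues mod n, represented by Fin n (values 0..n-1).
Cnr : ℕ → ℕ → Set
Cnr n r = Fin r → Fin n

Seq : ℕ → ℕ → ℕ → Set
Seq n r m = Fin m → Cnr n r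

ZeroSum : {n r L : ℕ} → (Fin L → Cnr n r) → Set
ZeroSum {n} {r} {L} t = (j : Fin r) → n ∣ finSum L (λ i → toℕ (t i j))

HasZeroSumSubseq : {n r m : ℕ} → (L : ℕ) → Seq n r m → Set
HasZeroSumSubseq {m = m} L s =
  Σ (Fin L → Fin m) λ ι → Injective _≡_ _≡_ ι × ZeroSum (λ i → s (ι i))

EveryHasZS : (k n r m : ℕ) → Set
EveryHasZS k n r m = (s : Seq n r m) → HasZeroSumSubseq (k * n) s

-- "s_{kn}(C_n^r) > X" for a rational X: since s_{kn} is the least m with
-- EveryHasZS k n r m, it exceeds X iff no natural m ≤ X has that property.
s-gt : (k n r : ℕ) → ℚ → Set
s-gt k n r X = (m : ℕ) → (+ m Q./ 1) Q.≤ X → ¬ EveryHasZS k n r m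

_^ℚ_ : ℚ → ℕ → ℚ
q ^ℚ zero  = 1ℚ
q ^ℚ suc r = q Q.* (q ^ℚ r)

module Submission where

-- Choose m vectors of C_n^r with independent coordinates, equal to 1 with
-- probability 1/5 and to 0 otherwise. A given coordinate of the sum of 2n of
-- them vanishes mod n iff the sum is 0, n or 2n, so with probability
-- (4/5)^2n (1 + θ), where θ = C(2n,n) / 4^n + 1 / 16^n; the value 1/5 makes the
-- terms 0 and n comparable. A union bound over the 2n-subsets, whose number is
-- at most m^2n / (2n)!, gives a sequence without a zero-sum subsequence as soon
-- as m ≤ (n/2) (5/4)^r (1 - θ/2n)^r, because (1 - θ/2n)^2n (1 + θ) ≤ 1 and
-- (2n)! > (n/2)^2n. Finally ε(n) = (5/4) θ/2n is O(n^-3/2) since C(2n,n)² (2n + 1) ≤ 16^n.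

open import Defs
open import Data.Product using (Σ; ∃; _×_; _,_)

-- Weighted counting of words and the union bound.

module Counting where
  open import Data.Bool using (Bool; true; false)
  open import Data.Fin using (zero; suc)
  open import Data.List using (List; []; _∷_; _++_; map; length; cartesianProductWith)
  open import Data.List.Properties using (map-++; map-∘; map-cong; length-map; length-++)
  open import Data.List.Relation.Unary.All using (All; []; _∷_)
  open import Data.List.Relation.Unary.All.Properties using (++⁺; map⁺)
  import Data.List.Relation.Unary.All as All
  open import Data.Nat
  open import Data.Nat.ListAction using (sum)
  open import Data.Nat.ListAction.Properties using (sum-++)
  open import Data.Nat.Properties
  open import Data.Nat.Tactic.RingSolver using (solve-∀)
  open import Data.Product using (Σ; _×_; _,_)
  open import Data.Vec using (Vec; []; _∷_; lookup)
  open import Function using (_∘_)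
  open import Relation.Binary.PropositionalEquality

  private variable
    A B C : Set
    k m r : ℕ

  ∑ : List A → (A → ℕ) → ℕ
  ∑ xs f = sum (map f xs)

  ∑-++ : (xs ys : List A) (f : A → ℕ) → ∑ (xs ++ ys) f ≡ ∑ xs f + ∑ ys f
  ∑-++ xs ys f = trans (cong sum (map-++ f xs ys)) (sum-++ (map f xs) (map f ys))

  ∑-map : (g : A → B) (xs : List A) (f : B → ℕ) → ∑ (map g xs) f ≡ ∑ xs (f ∘ g)
  ∑-map g xs f = cong sum (sym (map-∘ xs))

  ∑-cong : (xs : List A) {f g : A → ℕ} → (∀ x → f x ≡ g x) → ∑ xs f ≡ ∑ xs g
  ∑-cong xs f≗g = cong sum (map-cong f≗g xs)

  ∑-mono : (xs : List A) {f g : A → ℕ} → (∀ x → f x ≤ g x) → ∑ xs f ≤ ∑ xs g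
  ∑-mono []       f≤g = z≤n
  ∑-mono (x ∷ xs) f≤g = +-mono-≤ (f≤g x) (∑-mono xs f≤g)

  ∑-constant : {xs : List A} {f : A → ℕ} {c : ℕ} → All (λ x → f x ≡ c) xs → ∑ xs f ≡ length xs * c
  ∑-constant []         = refl
  ∑-constant (fx≡c ∷ p) = cong₂ _+_ fx≡c (∑-constant p)

  ∑-+ : (xs : List A) (f g : A → ℕ) → ∑ xs (λ x → f x + g x) ≡ ∑ xs f + ∑ xs g
  ∑-+ []       f g = refl
  ∑-+ (x ∷ xs) f g = trans (cong (f x + g x +_) (∑-+ xs f g)) (interchange (f x) (g x) _ _)
    where
    interchange : ∀ a b c d → a + b + (c + d) ≡ a + c + (b + d)
    interchange = solve-∀

  *-∑ : (c : ℕ) (xs : List A) (f : A → ℕ) → c * ∑ xs f ≡ ∑ xs (λ x → c * f x)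
  *-∑ c []       f = *-zeroʳ c
  *-∑ c (x ∷ xs) f = trans (*-distribˡ-+ c (f x) _) (cong (c * f x +_) (*-∑ c xs f))

  ∑-swap : (xs : List A) (ys : List B) (f : A → B → ℕ) →
    ∑ xs (λ x → ∑ ys (f x)) ≡ ∑ ys (λ y → ∑ xs (λ x → f x y))
  ∑-swap []       ys f = sym (trans (∑-constant (All.universal (λ _ → refl) ys)) (*-zeroʳ (length ys)))
  ∑-swap (x ∷ xs) ys f = trans (cong (∑ ys (f x) +_) (∑-swap xs ys f)) (sym (∑-+ ys (f x) _))

  ∑-cartesianProductWith : (f : A → B → C) (xs : List A) (ys : List B) (h : C → ℕ) →
    ∑ (cartesianProductWith f xs ys) h ≡ ∑ xs (λ x → ∑ ys (λ y → h (f x y)))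
  ∑-cartesianProductWith f []       ys h = refl
  ∑-cartesianProductWith f (x ∷ xs) ys h = trans (∑-++ (map (f x) ys) _ h)
    (cong₂ _+_ (∑-map (f x) ys h) (∑-cartesianProductWith f xs ys h))

  words : List A → (r : ℕ) → List (Vec A r)
  words xs zero    = [] ∷ []
  words xs (suc r) = cartesianProductWith _∷_ xs (words xs r)

  length-cartesianProductWith : (f : A → B → C) (xs : List A) (ys : List B) →
    length (cartesianProductWith f xs ys) ≡ length xs * length ys
  length-cartesianProductWith f []       ys = refl
  length-cartesianProductWith f (x ∷ xs) ys = trans (length-++ (map (f x) ys))
    (cong₂ _+_ (length-map (f x) ys) (length-cartesianProductWith f xs ys))

  length-words : (xs : List A) (r : ℕ) → length (words xs r) ≡ length xs ^ r
  length-words xs zero    = refl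
  length-words xs (suc r) = trans (length-cartesianProductWith _∷_ xs (words xs r))
    (cong (length xs *_) (length-words xs r))

  ∏ : (A → ℕ) → Vec A r → ℕ
  ∏ g []      = 1
  ∏ g (x ∷ v) = g x * ∏ g v

  1≤∏ : (g : A → ℕ) (v : Vec A r) → (∀ j → 1 ≤ g (lookup v j)) → 1 ≤ ∏ g v
  1≤∏ g []      p = ≤-refl
  1≤∏ g (x ∷ v) p = *-mono-≤ (p zero) (1≤∏ g v (p ∘ suc))

  -- Independence of the coordinates: by distributivity, a product of r equal sums expands into one
  -- product per word.
  ∑-words-∏ : (xs : List A) (g : A → ℕ) (r : ℕ) → ∑ (words xs r) (∏ g) ≡ ∑ xs g ^ r
  ∑-words-∏ xs g zero    = refl
  ∑-words-∏ xs g (suc r) = begin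
    ∑ (words xs (suc r)) (∏ g)                    ≡⟨ ∑-cartesianProductWith _∷_ xs (words xs r) (∏ g) ⟩
    ∑ xs (λ x → ∑ (words xs r) (λ v → g x * ∏ g v)) ≡⟨ ∑-cong xs (λ x → sym (*-∑ (g x) (words xs r) (∏ g))) ⟩
    ∑ xs (λ x → g x * ∑ (words xs r) (∏ g))       ≡⟨ ∑-cong xs (λ x → cong (g x *_) (∑-words-∏ xs g r)) ⟩
    ∑ xs (λ x → g x * ∑ xs g ^ r)                 ≡⟨ ∑-cong xs (λ x → *-comm (g x) _) ⟩
    ∑ xs (λ x → ∑ xs g ^ r * g x)                 ≡⟨ *-∑ (∑ xs g ^ r) xs g ⟨
    ∑ xs g ^ r * ∑ xs g                           ≡⟨ *-comm (∑ xs g ^ r) _ ⟩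
    ∑ xs g ^ suc r                                ∎
    where open ≡-Reasoning

  -- Subsets as bit vectors.

  size : Vec Bool m → ℕ
  size []          = 0
  size (true  ∷ S) = suc (size S)
  size (false ∷ S) = size S

  -- When `v` holds one coordinate of each of the m vectors, this is that coordinate of the sum over
  -- `S`, taken in the integers.
  meet : Vec Bool m → Vec Bool m → ℕ
  meet []          []          = 0
  meet (false ∷ S) (_ ∷ v)     = meet S v
  meet (true ∷ S)  (false ∷ v) = meet S v
  meet (true ∷ S)  (true ∷ v)  = suc (meet S v)

  meet≤size : (S v : Vec Bool m) → meet S v ≤ size S
  meet≤size []          []          = z≤n
  meet≤size (false ∷ S) (_ ∷ v)     = meet≤size S v
  meet≤size (true ∷ S)  (false ∷ v) = m≤n⇒m≤1+n (meet≤size S v)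
  meet≤size (true ∷ S)  (true ∷ v)  = s≤s (meet≤size S v)

  subsets : (m k : ℕ) → List (Vec Bool m)
  subsets zero    zero    = [] ∷ []
  subsets zero    (suc k) = []
  subsets (suc m) zero    = map (false ∷_) (subsets m zero)
  subsets (suc m) (suc k) = map (true ∷_) (subsets m k) ++ map (false ∷_) (subsets m (suc k))

  subsets-size : ∀ m k → All (λ S → size S ≡ k) (subsets m k)
  subsets-size zero    zero    = refl ∷ []
  subsets-size zero    (suc k) = []
  subsets-size (suc m) zero    = map⁺ (subsets-size m zero)
  subsets-size (suc m) (suc k) =
    ++⁺ (map⁺ (All.map (cong suc) (subsets-size m k))) (map⁺ (subsets-size m (suc k)))

  -- The first bit of `S` decides which half of the list to search. Completeness of the enumeration
  -- enters the union bound in this form: one bad subset already contributes its weight.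
  ∑-subsets-≥ : (S : Vec Bool m) → size S ≡ k → (f : Vec Bool m → ℕ) → f S ≤ ∑ (subsets m k) f
  ∑-subsets-≥ {k = zero}  []          _  f = m≤m+n _ _
  ∑-subsets-≥ {m = suc m} {zero}  (false ∷ S) eq f =
    ≤-trans (∑-subsets-≥ S eq (f ∘ (false ∷_))) (≤-reflexive (sym (∑-map _ (subsets m zero) f)))
  ∑-subsets-≥ {m = suc m} {suc k} (b ∷ S) eq f = begin
    f (b ∷ S) ≤⟨ bound b eq ⟩
    ∑ (subsets m k) (f ∘ (true ∷_)) + ∑ (subsets m (suc k)) (f ∘ (false ∷_))
      ≡⟨ cong₂ _+_ (∑-map _ (subsets m k) f) (∑-map _ (subsets m (suc k)) f) ⟨
    ∑ (map (true ∷_) (subsets m k)) f + ∑ (map (false ∷_) (subsets m (suc k))) f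
      ≡⟨ ∑-++ (map (true ∷_) (subsets m k)) _ f ⟨
    ∑ (subsets (suc m) (suc k)) f ∎
    where
    open ≤-Reasoning
    bound : ∀ b → size (b ∷ S) ≡ suc k →
      f (b ∷ S) ≤ ∑ (subsets m k) (f ∘ (true ∷_)) + ∑ (subsets m (suc k)) (f ∘ (false ∷_))
    bound true  eq = ≤-trans (∑-subsets-≥ S (suc-injective eq) (f ∘ (true ∷_))) (m≤m+n _ _)
    bound false eq = ≤-trans (∑-subsets-≥ S eq (f ∘ (false ∷_))) (m≤n+m _ _)

  -- `false` occurs four times, so that plain counting over `words letters m` models independent
  -- bits equal to 1 with probability 1/5.
  letters : List Bool
  letters = false ∷ false ∷ false ∷ false ∷ true ∷ []

  -- 5 ^ k times the expectation of g at a binomial variable with k trials and success probability 1/5.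
  binomialSum : ℕ → (ℕ → ℕ) → ℕ
  binomialSum zero    g = g 0
  binomialSum (suc k) g = 4 * binomialSum k g + binomialSum k (g ∘ suc)

  -- A letter outside `S` is free and gives a factor 5; inside `S`, four of the five letters keep
  -- `g` and one shifts it, as in the recursion of `binomialSum`. The factor `5 ^ size S` stands in
  -- for a division.
  ∑-meet : (S : Vec Bool m) (g : ℕ → ℕ) →
    5 ^ size S * ∑ (words letters m) (g ∘ meet S) ≡ 5 ^ m * binomialSum (size S) g
  ∑-meet []                g = trans (+-identityʳ _) (trans (+-identityʳ _) (sym (+-identityʳ _)))
  ∑-meet {suc m} (false ∷ S) g = begin
    5 ^ size S * ∑ (words letters (suc m)) (g ∘ meet (false ∷ S))
      ≡⟨ cong (5 ^ size S *_) (∑-cartesianProductWith _∷_ letters (words letters m) _) ⟩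
    5 ^ size S * (X + (X + (X + (X + (X + 0)))))
      ≡⟨ collect (5 ^ size S) X ⟩
    5 * (5 ^ size S * X)
      ≡⟨ cong (5 *_) (∑-meet S g) ⟩
    5 * (5 ^ m * binomialSum (size S) g)
      ≡⟨ *-assoc 5 (5 ^ m) _ ⟨
    5 ^ suc m * binomialSum (size S) g ∎
    where
    open ≡-Reasoning
    X = ∑ (words letters m) (g ∘ meet S)
    collect : ∀ a x → a * (x + (x + (x + (x + (x + 0))))) ≡ 5 * (a * x)
    collect = solve-∀
  ∑-meet {suc m} (true ∷ S) g = begin
    5 ^ suc (size S) * ∑ (words letters (suc m)) (g ∘ meet (true ∷ S))
      ≡⟨ cong (5 ^ suc (size S) *_) (∑-cartesianProductWith _∷_ letters (words letters m) _) ⟩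
    5 ^ suc (size S) * (X + (X + (X + (X + (Y + 0)))))
      ≡⟨ collect (5 ^ size S) X Y ⟩
    5 * (4 * (5 ^ size S * X) + 5 ^ size S * Y)
      ≡⟨ cong (5 *_) (cong₂ (λ x y → 4 * x + y) (∑-meet S g) (∑-meet S (g ∘ suc))) ⟩
    5 * (4 * (5 ^ m * P) + 5 ^ m * Q)
      ≡⟨ distribute (5 ^ m) P Q ⟩
    5 ^ suc m * binomialSum (suc (size S)) g ∎
    where
    open ≡-Reasoning
    X = ∑ (words letters m) (g ∘ meet S)
    Y = ∑ (words letters m) (g ∘ suc ∘ meet S)
    P = binomialSum (size S) g
    Q = binomialSum (size S) (g ∘ suc)
    collect : ∀ a x y → 5 * a * (x + (x + (x + (x + (y + 0))))) ≡ 5 * (4 * (a * x) + a * y)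
    collect = solve-∀
    distribute : ∀ a p q → 5 * (4 * (a * p) + a * q) ≡ 5 * a * (4 * p + q)
    distribute = solve-∀

  *-distribʳ-^ : ∀ a b r → (a * b) ^ r ≡ a ^ r * b ^ r
  *-distribʳ-^ a b zero    = refl
  *-distribʳ-^ a b (suc r) = trans (cong (a * b *_) (*-distribʳ-^ a b r)) (interchange a b _ _)
    where
    interchange : ∀ a b c d → a * b * (c * d) ≡ a * c * (b * d)
    interchange = solve-∀

  -- Double counting over all matrices of r columns of m bits, where `g` marks the bad intersection
  -- sizes. Every matrix has a bad subset, so it contributes at least 1 to the sum over subsets.
  -- After the two sums are exchanged, independence of the columns gives every subset the same
  -- total.
  union-bound : ∀ m k r (g : ℕ → ℕ) →
    ((V : Vec (Vec Bool m) r) → Σ (Vec Bool m) λ S →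
      size S ≡ k × (∀ j → 1 ≤ g (meet S (lookup V j)))) →
    (5 ^ k) ^ r ≤ length (subsets m k) * binomialSum k g ^ r
  -- The factor `(5 ^ m) ^ r` is the number of matrices, counted with multiplicity.
  union-bound m k r g hit = *-cancelʳ-≤ _ _ ((5 ^ m) ^ r) {{m^n≢0 (5 ^ m) r {{m^n≢0 5 m}}}} (begin
    (5 ^ k) ^ r * (5 ^ m) ^ r
      ≡⟨ cong ((5 ^ k) ^ r *_) (cong (_^ r) (length-words letters m)) ⟨
    (5 ^ k) ^ r * length columns ^ r
      ≡⟨ cong ((5 ^ k) ^ r *_) (trans (∑-constant (All.universal (λ _ → refl) matrices))
           (trans (*-identityʳ _) (length-words columns r))) ⟨
    (5 ^ k) ^ r * ∑ matrices (λ _ → 1)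
      ≤⟨ *-monoʳ-≤ ((5 ^ k) ^ r) (∑-mono matrices hit-sum) ⟩
    (5 ^ k) ^ r * ∑ matrices (λ V → ∑ (subsets m k) (λ S → ∏ (g ∘ meet S) V))
      ≡⟨ cong ((5 ^ k) ^ r *_) (∑-swap matrices (subsets m k) _) ⟩
    (5 ^ k) ^ r * ∑ (subsets m k) (λ S → ∑ matrices (∏ (g ∘ meet S)))
      ≡⟨ *-∑ ((5 ^ k) ^ r) (subsets m k) _ ⟩
    ∑ (subsets m k) (λ S → (5 ^ k) ^ r * ∑ matrices (∏ (g ∘ meet S)))
      ≡⟨ ∑-constant (All.map (λ {S} → column-sums S) (subsets-size m k)) ⟩
    length (subsets m k) * (binomialSum k g ^ r * (5 ^ m) ^ r)
      ≡⟨ *-assoc (length (subsets m k)) _ _ ⟨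
    length (subsets m k) * binomialSum k g ^ r * (5 ^ m) ^ r ∎)
    where
    open ≤-Reasoning
    columns : List (Vec Bool m)
    columns = words letters m
    matrices : List (Vec (Vec Bool m) r)
    matrices = words columns r
    hit-sum : ∀ V → 1 ≤ ∑ (subsets m k) (λ S → ∏ (g ∘ meet S) V)
    hit-sum V with hit V
    ... | S , |S|≡k , p = ≤-trans (1≤∏ (g ∘ meet S) V p) (∑-subsets-≥ S |S|≡k (λ S → ∏ (g ∘ meet S) V))
    column-sums : ∀ S → size S ≡ k →
      (5 ^ k) ^ r * ∑ matrices (∏ (g ∘ meet S)) ≡ binomialSum k g ^ r * (5 ^ m) ^ r
    column-sums S refl = begin-equality
      (5 ^ k) ^ r * ∑ matrices (∏ (g ∘ meet S))
        ≡⟨ cong ((5 ^ k) ^ r *_) (∑-words-∏ columns (g ∘ meet S) r) ⟩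
      (5 ^ k) ^ r * ∑ columns (g ∘ meet S) ^ r
        ≡⟨ *-distribʳ-^ (5 ^ k) _ r ⟨
      (5 ^ k * ∑ columns (g ∘ meet S)) ^ r
        ≡⟨ cong (_^ r) (trans (∑-meet S g) (*-comm (5 ^ m) _)) ⟩
      (binomialSum k g * 5 ^ m) ^ r
        ≡⟨ *-distribʳ-^ (binomialSum k g) _ r ⟩
      binomialSum k g ^ r * (5 ^ m) ^ r ∎

  binomialSum-+ : ∀ k (f g : ℕ → ℕ) →
    binomialSum k (λ t → f t + g t) ≡ binomialSum k f + binomialSum k g
  binomialSum-+ zero    f g = refl
  binomialSum-+ (suc k) f g = trans
    (cong₂ (λ x y → 4 * x + y) (binomialSum-+ k f g) (binomialSum-+ k (f ∘ suc) (g ∘ suc)))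
    (rearrange (binomialSum k f) (binomialSum k g) _ _)
    where
    rearrange : ∀ a b c d → 4 * (a + b) + (c + d) ≡ 4 * a + c + (4 * b + d)
    rearrange = solve-∀

  -- The Kronecker delta, recursive in both arguments so that δ (suc j) ∘ suc is δ j definitionally.
  δ : ℕ → ℕ → ℕ
  δ zero    zero    = 1
  δ zero    (suc t) = 0
  δ (suc j) zero    = 0
  δ (suc j) (suc t) = δ j t

  δ-refl : ∀ j → δ j j ≡ 1
  δ-refl zero    = refl
  δ-refl (suc j) = δ-refl j

-- Binomial weights and central binomial coefficients.

module Binomials where
  open Counting
  open import Data.Bool using (true; false)
  open import Data.List using (length; map)
  open import Data.List.Properties using (length-map; length-++)
  open import Data.Nat
  open import Data.Nat.Combinatorics
  open import Data.Nat.Divisibility using (_∣_)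
  open import Data.Nat.DivMod using (m/n*n≡m)
  open import Data.Nat.Properties
  open import Data.Nat.Tactic.RingSolver using (solve-∀)
  open import Data.Vec using (_∷_)
  open import Relation.Binary.PropositionalEquality

  binomialSum-0 : ∀ k → binomialSum k (λ _ → 0) ≡ 0
  binomialSum-0 zero    = refl
  binomialSum-0 (suc k) = cong (λ x → 4 * x + x) (binomialSum-0 k)

  -- The weight of j successes is C(k,j) 4^(k-j), by Pascal's rule; the factor `4 ^ j` avoids the
  -- subtraction in the exponent.
  binomialSum-δ : ∀ k j → binomialSum k (δ j) * 4 ^ j ≡ (k C j) * 4 ^ k
  binomialSum-δ zero    zero    = refl
  binomialSum-δ zero    (suc j) = refl
  binomialSum-δ (suc k) zero    = begin
    (4 * binomialSum k (δ 0) + binomialSum k (λ _ → 0)) * 1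
      ≡⟨ cong (λ x → (4 * binomialSum k (δ 0) + x) * 1) (binomialSum-0 k) ⟩
    (4 * binomialSum k (δ 0) + 0) * 1
      ≡⟨ rearrange (binomialSum k (δ 0)) ⟩
    4 * (binomialSum k (δ 0) * 1)
      ≡⟨ cong (4 *_) (binomialSum-δ k 0) ⟩
    4 * (1 * 4 ^ k)
      ≡⟨ *-identityˡ-inner (4 ^ k) ⟩
    1 * (4 * 4 ^ k)                                         ∎
    where
    open ≡-Reasoning
    rearrange : ∀ x → (4 * x + 0) * 1 ≡ 4 * (x * 1)
    rearrange = solve-∀
    *-identityˡ-inner : ∀ x → 4 * (1 * x) ≡ 1 * (4 * x)
    *-identityˡ-inner = solve-∀
  binomialSum-δ (suc k) (suc j) = begin
    (4 * binomialSum k (δ (suc j)) + binomialSum k (δ j)) * 4 ^ suc j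
      ≡⟨ expand (binomialSum k (δ (suc j))) _ (4 ^ j) ⟩
    4 * (binomialSum k (δ (suc j)) * 4 ^ suc j) + 4 * (binomialSum k (δ j) * 4 ^ j)
      ≡⟨ cong₂ (λ x y → 4 * x + 4 * y) (binomialSum-δ k (suc j)) (binomialSum-δ k j) ⟩
    4 * ((k C suc j) * 4 ^ k) + 4 * ((k C j) * 4 ^ k)
      ≡⟨ collect (k C suc j) (k C j) (4 ^ k) ⟩
    (k C j + k C suc j) * 4 ^ suc k
      ≡⟨ cong (_* 4 ^ suc k) (nCk+nC[k+1]≡[n+1]C[k+1] k j) ⟩
    (suc k C suc j) * 4 ^ suc k ∎
    where
    open ≡-Reasoning
    expand : ∀ x y z → (4 * x + y) * (4 * z) ≡ 4 * (x * (4 * z)) + 4 * (y * z)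
    expand = solve-∀
    collect : ∀ x y z → 4 * (x * z) + 4 * (y * z) ≡ (y + x) * (4 * z)
    collect = solve-∀

  central : ℕ → ℕ
  central n = (2 * n) C n

  -- For n > 0 and t ≤ 2n, the indicator of n dividing t, written as a sum so that `binomialSum-+`
  -- splits it.
  multiples : ℕ → ℕ → ℕ
  multiples n t = δ 0 t + (δ n t + δ (2 * n) t)

  4^[2*n]≡4^n*4^n : ∀ n → 4 ^ (2 * n) ≡ 4 ^ n * 4 ^ n
  4^[2*n]≡4^n*4^n n = trans (cong (λ k → 4 ^ (n + k)) (+-identityʳ n)) (^-distribˡ-+-* 4 n n)

  16^n≡4^n*4^n : ∀ n → 16 ^ n ≡ 4 ^ n * 4 ^ n
  16^n≡4^n*4^n n = *-distribʳ-^ 4 4 n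

  -- excess n / 16 ^ n is the quantity θ of the header.
  excess : ℕ → ℕ
  excess n = central n * 4 ^ n + 1

  -- The values 0, n and 2n contribute 4^2n, C(2n,n) 4^n and 1. Divided by 5^2n, the total is the
  -- probability (4/5)^2n (1 + θ).
  binomialSum-multiples : ∀ n → binomialSum (2 * n) (multiples n) ≡ 16 ^ n + excess n
  binomialSum-multiples n = begin
    binomialSum (2 * n) (multiples n)
      ≡⟨ binomialSum-+ (2 * n) (δ 0) _ ⟩
    binomialSum (2 * n) (δ 0) + binomialSum (2 * n) (λ t → δ n t + δ (2 * n) t)
      ≡⟨ cong (binomialSum (2 * n) (δ 0) +_) (binomialSum-+ (2 * n) (δ n) (δ (2 * n))) ⟩
    binomialSum (2 * n) (δ 0) + (binomialSum (2 * n) (δ n) + binomialSum (2 * n) (δ (2 * n)))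
      ≡⟨ cong₂ _+_ none (cong₂ _+_ half full) ⟩
    16 ^ n + excess n ∎
    where
    open ≡-Reasoning
    none : binomialSum (2 * n) (δ 0) ≡ 16 ^ n
    none = begin
      binomialSum (2 * n) (δ 0)     ≡⟨ *-identityʳ _ ⟨
      binomialSum (2 * n) (δ 0) * 1 ≡⟨ binomialSum-δ (2 * n) 0 ⟩
      1 * 4 ^ (2 * n)               ≡⟨ *-identityˡ _ ⟩
      4 ^ (2 * n)                   ≡⟨ ^-*-assoc 4 2 n ⟨
      16 ^ n                        ∎
    half : binomialSum (2 * n) (δ n) ≡ central n * 4 ^ n
    half = *-cancelʳ-≡ _ _ (4 ^ n) {{m^n≢0 4 n}} (begin
      binomialSum (2 * n) (δ n) * 4 ^ n ≡⟨ binomialSum-δ (2 * n) n ⟩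
      central n * 4 ^ (2 * n)           ≡⟨ cong (central n *_) (4^[2*n]≡4^n*4^n n) ⟩
      central n * (4 ^ n * 4 ^ n)       ≡⟨ *-assoc (central n) _ _ ⟨
      central n * 4 ^ n * 4 ^ n         ∎)
    full : binomialSum (2 * n) (δ (2 * n)) ≡ 1
    full = *-cancelʳ-≡ _ _ (4 ^ (2 * n)) {{m^n≢0 4 (2 * n)}}
      (trans (binomialSum-δ (2 * n) (2 * n)) (cong (_* 4 ^ (2 * n)) (nCn≡1 (2 * n))))

  central-! : ∀ n → central n * (n ! * n !) ≡ (2 * n) !
  central-! n = begin
    central n * (n ! * n !)
      ≡⟨ cong (λ k → central n * (n ! * k !)) 2*n∸n≡n ⟨
    central n * (n ! * (2 * n ∸ n) !)
      ≡⟨ cong (_* (n ! * (2 * n ∸ n) !)) (nCk≡n!/k![n-k]! n≤2*n) ⟩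
    (2 * n) ! / (n ! * (2 * n ∸ n) !) * (n ! * (2 * n ∸ n) !)
      ≡⟨ m/n*n≡m (subst (_∣ (2 * n) !) (*-comm ((2 * n ∸ n) !) (n !)) ([n∸k]!k!∣n! n≤2*n)) ⟩
    (2 * n) ! ∎
    where
    open ≡-Reasoning
    instance _ = n !* (2 * n ∸ n) !≢0
    n≤2*n : n ≤ 2 * n
    n≤2*n = m≤m+n n (n + 0)
    2*n∸n≡n : 2 * n ∸ n ≡ n
    2*n∸n≡n = trans (m+n∸m≡n n (n + 0)) (+-identityʳ n)

  -- Multiplied by (n + 1) n!², both sides become (2n + 2)!.
  central-suc : ∀ n → central (suc n) * suc n ≡ 2 * suc (2 * n) * central n
  central-suc n = *-cancelʳ-≡ _ _ (suc n * (n ! * n !)) {{m*n≢0 (suc n) _ {{_}} {{n !* n !≢0}}}} (begin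
    central (suc n) * suc n * (suc n * (n ! * n !))
      ≡⟨ left (central (suc n)) n (n !) ⟩
    central (suc n) * (suc n ! * suc n !)
      ≡⟨ central-! (suc n) ⟩
    (2 * suc n) !
      ≡⟨ cong _! (*-suc 2 n) ⟩
    suc (suc (2 * n)) * (suc (2 * n) * (2 * n) !)
      ≡⟨ cong (λ x → suc (suc (2 * n)) * (suc (2 * n) * x)) (central-! n) ⟨
    suc (suc (2 * n)) * (suc (2 * n) * (central n * (n ! * n !)))
      ≡⟨ right n (central n) (n !) ⟩
    2 * suc (2 * n) * central n * (suc n * (n ! * n !)) ∎)
    where
    open ≡-Reasoning
    left : ∀ c n f → c * (1 + n) * ((1 + n) * (f * f)) ≡ c * ((1 + n) * f * ((1 + n) * f))
    left = solve-∀
    right : ∀ n c f → (2 + 2 * n) * ((1 + 2 * n) * (c * (f * f))) ≡ 2 * (1 + 2 * n) * c * ((1 + n) * (f * f))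
    right = solve-∀

  -- By `central-suc`, passing from n to n + 1 multiplies C(2n,n)² (2n + 1) by 4 (2n + 1)(2n + 3) /
  -- (n + 1)². This is below 16, because (2n + 1)(2n + 3) = 4 (n + 1)² - 1.
  central-bound : ∀ n → central n * central n * suc (2 * n) ≤ 16 ^ n
  central-bound zero    = ≤-refl
  central-bound (suc n) = *-cancelʳ-≤ _ _ (suc n * suc n) (begin
    central (suc n) * central (suc n) * suc (2 * suc n) * (suc n * suc n)
      ≡⟨ pull (central (suc n)) n ⟩
    central (suc n) * suc n * (central (suc n) * suc n) * (3 + 2 * n)
      ≡⟨ cong (λ x → x * x * (3 + 2 * n)) (central-suc n) ⟩
    2 * suc (2 * n) * central n * (2 * suc (2 * n) * central n) * (3 + 2 * n)
      ≡⟨ regroup n (central n) ⟩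
    central n * central n * suc (2 * n) * (4 * (suc (2 * n) * (3 + 2 * n)))
      ≤⟨ *-mono-≤ (central-bound n) (*-monoʳ-≤ 4 square≤) ⟩
    16 ^ n * (4 * (4 * (suc n * suc n)))
      ≡⟨ scale (16 ^ n) (suc n * suc n) ⟩
    16 ^ suc n * (suc n * suc n) ∎)
    where
    open ≤-Reasoning
    pull : ∀ c n → c * c * (1 + 2 * (1 + n)) * ((1 + n) * (1 + n)) ≡ c * (1 + n) * (c * (1 + n)) * (3 + 2 * n)
    pull = solve-∀
    regroup : ∀ n c → 2 * (1 + 2 * n) * c * (2 * (1 + 2 * n) * c) * (3 + 2 * n)
      ≡ c * c * (1 + 2 * n) * (4 * ((1 + 2 * n) * (3 + 2 * n)))
    regroup = solve-∀
    square : ∀ n → (1 + 2 * n) * (3 + 2 * n) + 1 ≡ 4 * ((1 + n) * (1 + n))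
    square = solve-∀
    square≤ : suc (2 * n) * (3 + 2 * n) ≤ 4 * (suc n * suc n)
    square≤ = ≤-trans (m≤m+n (suc (2 * n) * (3 + 2 * n)) 1) (≤-reflexive (square n))
    scale : ∀ x y → x * (4 * (4 * y)) ≡ 16 * x * y
    scale = solve-∀

  central≤4^n : ∀ n → central n ≤ 4 ^ n
  central≤4^n n = ≮⇒≥ λ 4^n<c → <-irrefl refl (begin-strict
    16 ^ n                              ≡⟨ 16^n≡4^n*4^n n ⟩
    4 ^ n * 4 ^ n                       <⟨ *-mono-< 4^n<c 4^n<c ⟩
    central n * central n               ≤⟨ m≤m*n _ (suc (2 * n)) ⟩
    central n * central n * suc (2 * n) ≤⟨ central-bound n ⟩
    16 ^ n                              ∎)
    where open ≤-Reasoning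

  -- Bounds for (2n)! and for the number of subsets.

  n!*n^k≤[n+k]! : ∀ n k → n ! * n ^ k ≤ (n + k) !
  n!*n^k≤[n+k]! n zero    = ≤-reflexive (trans (*-identityʳ _) (cong _! (sym (+-identityʳ n))))
  n!*n^k≤[n+k]! n (suc k) = begin
    n ! * (n * n ^ k)         ≡⟨ swap (n !) n (n ^ k) ⟩
    n * (n ! * n ^ k)         ≤⟨ *-mono-≤ (m≤n⇒m≤1+n (m≤m+n n k)) (n!*n^k≤[n+k]! n k) ⟩
    suc (n + k) * (n + k) !   ≡⟨ cong _! (+-suc n k) ⟨
    (n + suc k) !             ∎
    where
    open ≤-Reasoning
    swap : ∀ a b c → a * (b * c) ≡ b * (a * c)
    swap = solve-∀

  -- Since C(2n,n) n! = (n + 1) ... (2n) ≥ n^n, it follows that n^2n ≤ C(2n,n) n! n^n; then C(2n,n)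
  -- < 4^n and n! n^n ≤ (2n)! finish. The strictness yields the contradiction in
  -- `union-bound-fails`.
  n^[2n]<4^n*[2n]! : ∀ n .{{_ : NonZero n}} → n ^ (2 * n) < 4 ^ n * (2 * n) !
  n^[2n]<4^n*[2n]! n = begin-strict
    n ^ (2 * n)                  ≡⟨ cong (λ k → n ^ (n + k)) (+-identityʳ n) ⟩
    n ^ (n + n)                  ≡⟨ ^-distribˡ-+-* n n n ⟩
    n ^ n * n ^ n                ≤⟨ *-monoˡ-≤ (n ^ n) n^n≤ ⟩
    central n * n ! * n ^ n      ≡⟨ *-assoc (central n) _ _ ⟩
    central n * (n ! * n ^ n)    <⟨ *-monoˡ-< (n ! * n ^ n) {{m*n≢0 _ _ {{n !≢0}} {{m^n≢0 n n}}}} central<4^n ⟩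
    4 ^ n * (n ! * n ^ n)        ≤⟨ *-monoʳ-≤ (4 ^ n) n!*n^n≤ ⟩
    4 ^ n * (2 * n) !            ∎
    where
    open ≤-Reasoning
    n!*n^n≤ : n ! * n ^ n ≤ (2 * n) !
    n!*n^n≤ = ≤-trans (n!*n^k≤[n+k]! n n) (≤-reflexive (cong (λ k → (n + k) !) (sym (+-identityʳ n))))
    n^n≤ : n ^ n ≤ central n * n !
    n^n≤ = *-cancelʳ-≤ _ _ (n !) {{n !≢0}} (begin
      n ^ n * n !              ≡⟨ *-comm (n ^ n) _ ⟩
      n ! * n ^ n              ≤⟨ n!*n^n≤ ⟩
      (2 * n) !                ≡⟨ central-! n ⟨
      central n * (n ! * n !)  ≡⟨ *-assoc (central n) _ _ ⟨
      central n * n ! * n !    ∎)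
    4^n*4^n≢0 : NonZero (4 ^ n * 4 ^ n)
    4^n*4^n≢0 = m*n≢0 _ _ {{m^n≢0 4 n}} {{m^n≢0 4 n}}
    1<1+2*n : 1 < suc (2 * n)
    1<1+2*n = s≤s (≤-trans (>-nonZero⁻¹ n) (m≤m+n n _))
    central<4^n : central n < 4 ^ n
    central<4^n = ≰⇒> λ 4^n≤c → <-irrefl refl (begin-strict
      16 ^ n                              ≡⟨ 16^n≡4^n*4^n n ⟩
      4 ^ n * 4 ^ n                       <⟨ m<m*n _ (suc (2 * n)) {{4^n*4^n≢0}} 1<1+2*n ⟩
      4 ^ n * 4 ^ n * suc (2 * n)         ≤⟨ *-monoˡ-≤ (suc (2 * n)) (*-mono-≤ 4^n≤c 4^n≤c) ⟩
      central n * central n * suc (2 * n) ≤⟨ central-bound n ⟩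
      16 ^ n                              ∎)

  -- Bernoulli's inequality, made homogeneous to stay within the natural numbers.
  [x+y]^[1+k]≥ : ∀ x y k → (x + suc k * y) * x ^ k ≤ (x + y) ^ suc k
  [x+y]^[1+k]≥ x y zero    = ≤-reflexive (base x y)
    where
    base : ∀ x y → (x + 1 * y) * 1 ≡ (x + y) * 1
    base = solve-∀
  [x+y]^[1+k]≥ x y (suc k) = begin
    -- With the added term, `x ^ k` multiplies x² + (k + 2)xy + (k + 1)y² = (x + y)(x + (k + 1)y).
    (x + suc (suc k) * y) * (x * x ^ k)            ≤⟨ m≤m+n _ (suc k * y * y * x ^ k) ⟩
    (x + suc (suc k) * y) * (x * x ^ k) + suc k * y * y * x ^ k ≡⟨ factor x y k (x ^ k) ⟩
    (x + y) * ((x + suc k * y) * x ^ k)            ≤⟨ *-monoʳ-≤ (x + y) ([x+y]^[1+k]≥ x y k) ⟩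
    (x + y) ^ suc (suc k)                          ∎
    where
    open ≤-Reasoning
    factor : ∀ x y k p → (x + (2 + k) * y) * (x * p) + (1 + k) * y * y * p ≡ (x + y) * ((x + (1 + k) * y) * p)
    factor = solve-∀

  -- Pascal's rule leaves (k + 1) m^k + m^(k+1), which is at most (m + 1)^(k+1) by Bernoulli's
  -- inequality with y = 1.
  k!*length-subsets≤m^k : ∀ m k → k ! * length (subsets m k) ≤ m ^ k
  k!*length-subsets≤m^k zero    zero    = ≤-refl
  k!*length-subsets≤m^k zero    (suc k) = ≤-reflexive (*-zeroʳ (suc k !))
  k!*length-subsets≤m^k (suc m) zero    =
    ≤-trans (≤-reflexive (cong (1 *_) (length-map _ (subsets m 0)))) (k!*length-subsets≤m^k m 0)
  k!*length-subsets≤m^k (suc m) (suc k) = begin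
    suc k ! * length (subsets (suc m) (suc k))
      ≡⟨ cong (suc k ! *_) (trans (length-++ (map (true ∷_) (subsets m k)))
           (cong₂ _+_ (length-map _ (subsets m k)) (length-map _ (subsets m (suc k))))) ⟩
    suc k ! * (length (subsets m k) + length (subsets m (suc k)))
      ≡⟨ expand k (k !) (length (subsets m k)) (length (subsets m (suc k))) ⟩
    suc k * (k ! * length (subsets m k)) + suc k ! * length (subsets m (suc k))
      ≤⟨ +-mono-≤ (*-monoʳ-≤ (suc k) (k!*length-subsets≤m^k m k)) (k!*length-subsets≤m^k m (suc k)) ⟩
    suc k * m ^ k + m * m ^ k
      ≡⟨ collect k m (m ^ k) ⟩
    (m + suc k * 1) * m ^ k
      ≤⟨ [x+y]^[1+k]≥ m 1 k ⟩
    (m + 1) ^ suc k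
      ≡⟨ cong (_^ suc k) (+-comm m 1) ⟩
    suc m ^ suc k ∎
    where
    open ≤-Reasoning
    expand : ∀ k f a b → (1 + k) * f * (a + b) ≡ (1 + k) * (f * a) + (1 + k) * f * b
    expand = solve-∀
    collect : ∀ k m p → (1 + k) * p + m * p ≡ (m + (1 + k) * 1) * p
    collect = solve-∀

  -- The factor 1 - θ/2n and the failure of the union bound.

  denominator : ℕ → ℕ
  denominator n = 2 * n * 16 ^ n

  -- (1 - x)^(k+1) (1 + (k+1) x) ≤ 1 for x = a / D, where D = (k+1) u, cleared of denominators.
  E^[1+k]*[u+a]≤u*D^[1+k] : ∀ k u a E → suc k * u ≡ E + a →
    E ^ suc k * (u + a) ≤ u * (E + a) ^ suc k
  E^[1+k]*[u+a]≤u*D^[1+k] k u a E D≡E+a = begin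
    E * E ^ k * (u + a)                 ≡⟨ expand E (E ^ k) u a ⟩
    u * (E * E ^ k) + E * (a * E ^ k)   ≤⟨ +-monoʳ-≤ (u * (E * E ^ k)) (*-monoˡ-≤ (a * E ^ k) E≤D) ⟩
    u * (E * E ^ k) + suc k * u * (a * E ^ k) ≡⟨ collect u E (E ^ k) k a ⟩
    u * ((E + suc k * a) * E ^ k)       ≤⟨ *-monoʳ-≤ u ([x+y]^[1+k]≥ E a k) ⟩
    u * (E + a) ^ suc k                 ∎
    where
    open ≤-Reasoning
    E≤D : E ≤ suc k * u
    E≤D = ≤-trans (m≤m+n E a) (≤-reflexive (sym D≡E+a))
    expand : ∀ E p u a → E * p * (u + a) ≡ u * (E * p) + E * (a * p)
    expand = solve-∀
    collect : ∀ u E p k a → u * (E * p) + (1 + k) * u * (a * p) ≡ u * ((E + (1 + k) * a) * p)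
    collect = solve-∀

  -- In other words θ ≤ 2, from C(2n,n) ≤ 4^n; for n > 0 this keeps 1 - θ/2n nonnegative.
  excess≤2*16^n : ∀ n → excess n ≤ 2 * 16 ^ n
  excess≤2*16^n n = begin
    central n * 4 ^ n + 1     ≤⟨ +-mono-≤ (*-monoˡ-≤ (4 ^ n) (central≤4^n n)) (m^n>0 16 n) ⟩
    4 ^ n * 4 ^ n + 16 ^ n    ≡⟨ cong (_+ 16 ^ n) (16^n≡4^n*4^n n) ⟨
    16 ^ n + 16 ^ n           ≡⟨ cong (16 ^ n +_) (+-identityʳ _) ⟨
    2 * 16 ^ n                ∎
    where open ≤-Reasoning

  excess≤denominator : ∀ n .{{_ : NonZero n}} → excess n ≤ denominator n
  excess≤denominator n = ≤-trans (excess≤2*16^n n) (*-monoˡ-≤ (16 ^ n) (m≤m*n 2 n))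

  -- numerator n / denominator n = 1 - θ/2n; the subtraction is exact for n > 0.
  numerator : ℕ → ℕ
  numerator n = denominator n ∸ excess n

  numerator+excess : ∀ n .{{_ : NonZero n}} → numerator n + excess n ≡ denominator n
  numerator+excess n = m∸n+n≡m (excess≤denominator n)

  -- This is (1 - θ/2n)^2n (1 + θ) ≤ 1 with denominators cleared, the factor 16^n = 4^2n being
  -- absorbed into the power on the right.
  numerator-bound : ∀ n .{{_ : NonZero n}} →
    numerator n ^ (2 * n) * (16 ^ n + excess n) ≤ (4 * denominator n) ^ (2 * n)
  -- Matching on `n` exposes `2 * n` as a successor, the form of exponent that the inequality
  -- applied here requires.
  numerator-bound n@(suc n-1) = begin
    numerator n ^ (2 * n) * (16 ^ n + excess n)
      ≤⟨ E^[1+k]*[u+a]≤u*D^[1+k] (pred (2 * n)) (16 ^ n) (excess n) (numerator n) (sym (numerator+excess n)) ⟩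
    16 ^ n * (numerator n + excess n) ^ (2 * n)
      ≡⟨ cong₂ (λ x y → x * y ^ (2 * n)) (^-*-assoc 4 2 n) (numerator+excess n) ⟩
    4 ^ (2 * n) * denominator n ^ (2 * n)
      ≡⟨ *-distribʳ-^ 4 (denominator n) (2 * n) ⟨
    (4 * denominator n) ^ (2 * n) ∎
    where open ≤-Reasoning

  -- The hypothesis is m ≤ (n/2) (5/4)^r (1 - θ/2n)^r. If the union bound held, estimating the
  -- number of subsets by m^2n / (2n)! and inserting the 2n-th power of the hypothesis would cancel
  -- all dependence on r and leave 4^n (2n)! ≤ n^2n.
  union-bound-fails : ∀ n m r .{{_ : NonZero n}} →
    2 * m * (4 * denominator n) ^ r ≤ n * (5 * numerator n) ^ r →
    length (subsets m (2 * n)) * (16 ^ n + excess n) ^ r < (5 ^ (2 * n)) ^ r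
  union-bound-fails n m r h = ≰⇒> λ u → <⇒≱ (n^[2n]<4^n*[2n]! n)
    (*-cancelʳ-≤ _ _ (F ^ r * X ^ r) {{FX≢0}} (begin
    4 ^ n * k ! * (F ^ r * X ^ r)
      ≡⟨ shuffle₁ (4 ^ n) (k !) (F ^ r) (X ^ r) ⟩
    4 ^ n * k ! * X ^ r * F ^ r
      ≤⟨ *-monoʳ-≤ (4 ^ n * k ! * X ^ r) u ⟩
    4 ^ n * k ! * X ^ r * (b * A ^ r)
      ≡⟨ shuffle₂ (4 ^ n) (k !) (X ^ r) b (A ^ r) ⟩
    4 ^ n * (k ! * b) * X ^ r * A ^ r
      ≤⟨ *-monoˡ-≤ (A ^ r) (*-monoˡ-≤ (X ^ r) (*-monoʳ-≤ (4 ^ n) (k!*length-subsets≤m^k m k))) ⟩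
    4 ^ n * m ^ k * X ^ r * A ^ r
      ≡⟨ cong₂ (λ x y → x * y * A ^ r) power₁ (^-comm (4 * denominator n)) ⟩
    (2 * m) ^ k * ((4 * denominator n) ^ r) ^ k * A ^ r
      ≡⟨ cong (_* A ^ r) (*-distribʳ-^ (2 * m) _ k) ⟨
    (2 * m * (4 * denominator n) ^ r) ^ k * A ^ r
      ≤⟨ *-monoˡ-≤ (A ^ r) (^-monoˡ-≤ k h) ⟩
    (n * (5 * numerator n) ^ r) ^ k * A ^ r
      ≡⟨ cong (_* A ^ r) (trans (*-distribʳ-^ n _ k) (cong (n ^ k *_) (sym (^-comm (5 * numerator n))))) ⟩
    n ^ k * ((5 * numerator n) ^ k) ^ r * A ^ r
      ≡⟨ cong (λ x → n ^ k * x * A ^ r) (trans (cong (_^ r) (*-distribʳ-^ 5 (numerator n) k))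
           (*-distribʳ-^ F (numerator n ^ k) r)) ⟩
    n ^ k * (F ^ r * (numerator n ^ k) ^ r) * A ^ r
      ≡⟨ shuffle₃ (n ^ k) (F ^ r) ((numerator n ^ k) ^ r) (A ^ r) ⟩
    n ^ k * F ^ r * ((numerator n ^ k) ^ r * A ^ r)
      ≡⟨ cong (n ^ k * F ^ r *_) (*-distribʳ-^ (numerator n ^ k) A r) ⟨
    n ^ k * F ^ r * (numerator n ^ k * A) ^ r
      -- The factor 1 - θ/2n pays for the 1 + θ of each of the r coordinates.
      ≤⟨ *-monoʳ-≤ (n ^ k * F ^ r) (^-monoˡ-≤ r (numerator-bound n)) ⟩
    n ^ k * F ^ r * X ^ r
      ≡⟨ *-assoc (n ^ k) _ _ ⟩
    n ^ k * (F ^ r * X ^ r) ∎))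
    where
    open ≤-Reasoning
    k = 2 * n
    b = length (subsets m k)
    A = 16 ^ n + excess n
    F = 5 ^ k
    X = (4 * denominator n) ^ k
    X≢0 : NonZero X
    X≢0 = m^n≢0 _ k {{m*n≢0 4 _ {{_}} {{m*n≢0 (2 * n) _ {{m*n≢0 2 n}} {{m^n≢0 16 n}}}}}}
    FX≢0 : NonZero (F ^ r * X ^ r)
    FX≢0 = m*n≢0 _ _ {{m^n≢0 F r {{m^n≢0 5 k}}}} {{m^n≢0 X r {{X≢0}}}}
    ^-comm : ∀ x → (x ^ k) ^ r ≡ (x ^ r) ^ k
    ^-comm x = trans (^-*-assoc x k r) (trans (cong (x ^_) (*-comm k r)) (sym (^-*-assoc x r k)))
    power₁ : 4 ^ n * m ^ k ≡ (2 * m) ^ k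
    power₁ = trans (cong (_* m ^ k) (^-*-assoc 2 2 n)) (sym (*-distribʳ-^ 2 m k))
    shuffle₁ : ∀ a b c d → a * b * (c * d) ≡ a * b * d * c
    shuffle₁ = solve-∀
    shuffle₂ : ∀ a b c d e → a * b * c * (d * e) ≡ a * (b * d) * c * e
    shuffle₂ = solve-∀
    shuffle₃ : ∀ a b c d → a * (b * c) * d ≡ a * b * (c * d)
    shuffle₃ = solve-∀

  -- Since θ ≤ 2 central n / 4 ^ n, this is θ² n ≤ 2.
  excess²*n≤2*256^n : ∀ n → excess n * excess n * n ≤ 2 * (16 ^ n * 16 ^ n)
  excess²*n≤2*256^n n = begin
    excess n * excess n * n
      ≤⟨ *-monoˡ-≤ n (*-mono-≤ excess≤ excess≤) ⟩
    2 * (central n * 4 ^ n) * (2 * (central n * 4 ^ n)) * n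
      ≡⟨ regroup (central n) (4 ^ n) n ⟩
    2 * (central n * central n * (2 * n) * (4 ^ n * 4 ^ n))
      ≤⟨ *-monoʳ-≤ 2 (*-mono-≤
           (≤-trans (*-monoʳ-≤ (central n * central n) (n≤1+n (2 * n))) (central-bound n))
           (≤-reflexive (sym (16^n≡4^n*4^n n)))) ⟩
    2 * (16 ^ n * 16 ^ n) ∎
    where
    open ≤-Reasoning
    central≢0 : NonZero (central n)
    central≢0 = m*n≢0⇒m≢0 (central n) {{subst NonZero (sym (central-! n)) ((2 * n) !≢0)}}
    excess≤ : excess n ≤ 2 * (central n * 4 ^ n)
    excess≤ = +-monoʳ-≤ (central n * 4 ^ n)
      (≤-trans (>-nonZero⁻¹ _ {{m*n≢0 _ _ {{central≢0}} {{m^n≢0 4 n}}}}) (m≤m+n _ 0))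
    regroup : ∀ c p n → 2 * (c * p) * (2 * (c * p)) * n ≡ 2 * (c * c * (2 * n) * (p * p))
    regroup = solve-∀

-- From zero-sum subsequences to bad subsets.

module Selections where
  open Counting
  open Binomials
  open import Data.Bool using (Bool; true; false)
  open import Data.Bool.Properties using (¬-not)
  open import Data.Fin using (Fin; zero; suc; toℕ; _≟_)
  open import Data.Fin.Properties using (suc-injective; 0≢1+n)
  open import Data.Nat using (ℕ; zero; suc; _+_; _*_; _^_; _≤_; z≤n; s≤s; NonZero)
  open import Data.List using (length)
  open import Data.Nat.Divisibility using (_∣_; divides)
  open import Data.Nat.Properties hiding (suc-injective; 0≢1+n; _≟_)
  open import Data.Product using (Σ; ∃; _×_; _,_)
  open import Data.Vec using (Vec; []; _∷_; lookup; replicate; _[_]≔_)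
  open import Data.Vec.Properties using (lookup-replicate; lookup∘update′)
  open import Function using (_∘_)
  open import Function.Definitions using (Injective)
  open import Relation.Binary.PropositionalEquality
  open import Relation.Nullary using (yes; no; contradiction)

  private variable
    L m : ℕ

  bit : ∀ {n} → Bool → Fin (suc (suc n))
  bit false = zero
  bit true  = suc zero

  value : Bool → ℕ
  value false = 0
  value true  = 1

  toℕ-bit : ∀ {n} b → toℕ (bit {n} b) ≡ value b
  toℕ-bit false = refl
  toℕ-bit true  = refl

  finSum-cong : ∀ L {f g : Fin L → ℕ} → (∀ i → f i ≡ g i) → finSum L f ≡ finSum L g
  finSum-cong zero    f≗g = refl
  finSum-cong (suc L) f≗g = cong₂ _+_ (f≗g zero) (finSum-cong L (f≗g ∘ suc))

  -- Built by successive insertions: for injective `ι` each one hits a fresh position, so `size` and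
  -- `meet` can be followed step by step.
  image : (Fin L → Fin m) → Vec Bool m
  image {zero}  ι = replicate _ false
  image {suc L} ι = image (ι ∘ suc) [ ι zero ]≔ true

  ∈-image : (ι : Fin L → Fin m) (i : Fin m) → lookup (image ι) i ≡ true → ∃ λ l → ι l ≡ i
  ∈-image {zero}  ι i eq with () ← trans (sym (lookup-replicate i false)) eq
  ∈-image {suc L} ι i eq with ι zero ≟ i
  ... | yes ι0≡i = zero , ι0≡i
  ... | no  ι0≢i with ∈-image (ι ∘ suc) i
    (trans (sym (lookup∘update′ (ι0≢i ∘ sym) (image (ι ∘ suc)) true)) eq)
  ...   | l , ιl≡i = suc l , ιl≡i

  ∉-image-suc : (ι : Fin (suc L) → Fin m) → Injective _≡_ _≡_ ι →
    lookup (image (ι ∘ suc)) (ι zero) ≡ false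
  ∉-image-suc ι inj = ¬-not λ ∈ → let l , eq = ∈-image (ι ∘ suc) (ι zero) ∈ in 0≢1+n (inj (sym eq))

  meet-∅ : (v : Vec Bool m) → meet (replicate m false) v ≡ 0
  meet-∅ []      = refl
  meet-∅ (_ ∷ v) = meet-∅ v

  size-∅ : ∀ m → size (replicate m false) ≡ 0
  size-∅ zero    = refl
  size-∅ (suc m) = size-∅ m

  meet-insert : (S v : Vec Bool m) (p : Fin m) → lookup S p ≡ false →
    meet (S [ p ]≔ true) v ≡ value (lookup v p) + meet S v
  meet-insert (false ∷ S) (false ∷ v) zero    _ = refl
  meet-insert (false ∷ S) (true ∷ v)  zero    _ = refl
  meet-insert (false ∷ S) (_ ∷ v)     (suc p) e = meet-insert S v p e
  meet-insert (true ∷ S)  (false ∷ v) (suc p) e = meet-insert S v p e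
  meet-insert (true ∷ S)  (true ∷ v)  (suc p) e = trans (cong suc (meet-insert S v p e)) (sym (+-suc _ _))

  size-insert : (S : Vec Bool m) (p : Fin m) → lookup S p ≡ false → size (S [ p ]≔ true) ≡ suc (size S)
  size-insert (false ∷ S) zero    _ = refl
  size-insert (false ∷ S) (suc p) e = size-insert S p e
  size-insert (true ∷ S)  (suc p) e = cong suc (size-insert S p e)

  -- Each fresh insertion adds exactly its own bit. This identifies a coordinate of the sum of a
  -- subsequence with an intersection size.
  meet-image : (ι : Fin L → Fin m) → Injective _≡_ _≡_ ι → (v : Vec Bool m) →
    meet (image ι) v ≡ finSum L (λ l → value (lookup v (ι l)))
  meet-image {zero}  ι inj v = meet-∅ v
  meet-image {suc L} ι inj v = trans (meet-insert (image (ι ∘ suc)) v (ι zero) (∉-image-suc ι inj))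
    (cong (value (lookup v (ι zero)) +_) (meet-image (ι ∘ suc) (suc-injective ∘ inj) v))

  size-image : (ι : Fin L → Fin m) → Injective _≡_ _≡_ ι → size (image ι) ≡ L
  size-image {zero}  {m} ι inj = size-∅ m
  size-image {suc L} ι inj = trans (size-insert (image (ι ∘ suc)) (ι zero) (∉-image-suc ι inj))
    (cong suc (size-image (ι ∘ suc) (suc-injective ∘ inj)))

  -- The quotients 0, 1 and 2 match the three deltas; a larger one would exceed the bound 2n.
  1≤multiples : ∀ n t .{{_ : NonZero n}} → n ∣ t → t ≤ 2 * n → 1 ≤ multiples n t
  1≤multiples n _ (divides 0 refl) _ = s≤s z≤n
  1≤multiples n _ (divides 1 refl) _ = begin
    1                                               ≡⟨ δ-refl n ⟨
    δ n n                                           ≡⟨ cong (δ n) (+-identityʳ n) ⟨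
    δ n (1 * n)                                     ≤⟨ m≤m+n _ _ ⟩
    δ n (1 * n) + δ (2 * n) (1 * n)                 ≤⟨ m≤n+m _ (δ 0 (1 * n)) ⟩
    δ 0 (1 * n) + (δ n (1 * n) + δ (2 * n) (1 * n)) ∎
    where open ≤-Reasoning
  1≤multiples n _ (divides 2 refl) _ = begin
    1                                               ≡⟨ δ-refl (2 * n) ⟨
    δ (2 * n) (2 * n)                               ≤⟨ m≤n+m _ (δ n (2 * n)) ⟩
    δ n (2 * n) + δ (2 * n) (2 * n)                 ≤⟨ m≤n+m _ (δ 0 (2 * n)) ⟩
    δ 0 (2 * n) + (δ n (2 * n) + δ (2 * n) (2 * n)) ∎
    where open ≤-Reasoning
  1≤multiples n _ (divides (suc (suc (suc q))) refl) ≤2*n =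
    contradiction (*-cancelʳ-≤ (suc (suc (suc q))) 2 n ≤2*n) λ { (s≤s (s≤s ())) }

  -- A zero-sum selection from a 0/1 sequence has as image a subset whose intersection sizes are
  -- multiples of n and at most 2n, hence a bad subset for `union-bound`.
  EveryHasZS⇒≤ : ∀ n r m → let n′ = suc (suc n) in EveryHasZS 2 n′ r m →
    (5 ^ (2 * n′)) ^ r ≤ length (subsets m (2 * n′)) * (16 ^ n′ + excess n′) ^ r
  EveryHasZS⇒≤ n r m every = subst (λ x → (5 ^ (2 * n′)) ^ r ≤ length (subsets m (2 * n′)) * x ^ r)
    (binomialSum-multiples n′) (union-bound m (2 * n′) r (multiples n′) hit)
    where

    n′ = suc (suc n)
    hit : (V : Vec (Vec Bool m) r) → Σ (Vec Bool m) λ S →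
      size S ≡ 2 * n′ × (∀ j → 1 ≤ multiples n′ (meet S (lookup V j)))
    -- Column `j` of `V` holds coordinate `j` of all the terms, so the sequence is the transpose of
    -- `V`.
    hit V with every (λ i j → bit {n} (lookup (lookup V j) i))
    ... | ι , inj , zero-sum = image ι , size-image ι inj , λ j →
      1≤multiples n′ (meet (image ι) (lookup V j))
        (subst (n′ ∣_) (trans (finSum-cong (2 * n′) (λ l → toℕ-bit {n} (lookup (lookup V j) (ι l))))
           (sym (meet-image ι inj (lookup V j)))) (zero-sum j))
        (≤-trans (meet≤size (image ι) (lookup V j)) (≤-reflexive (size-image ι inj)))

-- Rational arithmetic by cross multiplication.

module Fractions where
  open import Data.Integer using (+_; +≤+)
  import Data.Integer as Z
  import Data.Integer.Properties as Z
  open import Data.Nat using (ℕ; zero; suc; NonZero)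
  import Data.Nat as N
  import Data.Nat.Properties as N
  open import Data.Rational hiding (NonZero)
  open import Data.Rational.Properties
  import Data.Rational.Unnormalised as U
  import Data.Rational.Unnormalised.Properties as U
  open import Relation.Binary.PropositionalEquality

  -- Since `_/_` reduces to lowest terms, products, sums and comparisons are carried out on
  -- unnormalised fractions and carried back through this equivalence.
  toℚᵘ-/ : ∀ p d .{{_ : NonZero d}} → toℚᵘ (+ p / d) U.≃ (+ p U./ d)
  toℚᵘ-/ p (suc d) = toℚᵘ-fromℚᵘ (+ p U./ suc d)

  /-cross : ∀ p q d e .{{_ : NonZero d}} .{{_ : NonZero e}} → p N.* e ≡ q N.* d → + p / d ≡ + q / e
  /-cross p q (suc d) (suc e) eq = fromℚᵘ-cong {+ p U./ suc d} {+ q U./ suc e}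
    (U.*≡* (trans (sym (Z.pos-* p (suc e))) (trans (cong +_ eq) (Z.pos-* q (suc d)))))

  /-mono-≤ : ∀ p q d e .{{_ : NonZero d}} .{{_ : NonZero e}} → p N.* e N.≤ q N.* d → + p / d ≤ + q / e
  /-mono-≤ p q (suc d) (suc e) le = toℚᵘ-cancel-≤ (U.≤-respˡ-≃ (U.≃-sym (toℚᵘ-/ p (suc d)))
    (U.≤-respʳ-≃ (U.≃-sym (toℚᵘ-/ q (suc e)))
      (U.*≤* (subst₂ Z._≤_ (Z.pos-* p (suc e)) (Z.pos-* q (suc d)) (+≤+ le)))))

  /-cancel-≤ : ∀ p q d e .{{_ : NonZero d}} .{{_ : NonZero e}} → + p / d ≤ + q / e → p N.* e N.≤ q N.* d
  /-cancel-≤ p q (suc d) (suc e) le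
    with U.≤-respˡ-≃ (toℚᵘ-/ p (suc d)) (U.≤-respʳ-≃ (toℚᵘ-/ q (suc e)) (toℚᵘ-mono-≤ le))
  ... | U.*≤* le′ = Z.drop‿+≤+ (subst₂ Z._≤_ (sym (Z.pos-* p (suc e))) (sym (Z.pos-* q (suc d))) le′)

  /-* : ∀ p q d e .{{_ : NonZero d}} .{{_ : NonZero e}} →
    (+ p / d) * (+ q / e) ≡ _/_ (+ (p N.* q)) (d N.* e) {{N.m*n≢0 d e}}
  /-* p q d@(suc _) e@(suc _) = toℚᵘ-injective (begin
    toℚᵘ ((+ p / d) * (+ q / e))         ≈⟨ toℚᵘ-homo-* (+ p / d) (+ q / e) ⟩
    toℚᵘ (+ p / d) U.* toℚᵘ (+ q / e)    ≈⟨ U.*-cong (toℚᵘ-/ p d) (toℚᵘ-/ q e) ⟩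
    (+ p U./ d) U.* (+ q U./ e)          ≡⟨ cong (U._/ (d N.* e)) (sym (Z.pos-* p q)) ⟩
    (+ (p N.* q)) U./ (d N.* e)          ≈⟨ toℚᵘ-/ (p N.* q) (d N.* e) ⟨
    toℚᵘ (+ (p N.* q) / (d N.* e))       ∎)
    where open U.≃-Reasoning

  /-+ : ∀ p q d .{{_ : NonZero d}} → (+ p / d) + (+ q / d) ≡ + (p N.+ q) / d
  /-+ p q d@(suc _) = toℚᵘ-injective (begin
    toℚᵘ ((+ p / d) + (+ q / d))         ≈⟨ toℚᵘ-homo-+ (+ p / d) (+ q / d) ⟩
    toℚᵘ (+ p / d) U.+ toℚᵘ (+ q / d)    ≈⟨ U.+-cong (toℚᵘ-/ p d) (toℚᵘ-/ q d) ⟩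
    (+ p U./ d) U.+ (+ q U./ d)          ≈⟨ U.*≡* cross ⟩
    (+ (p N.+ q)) U./ d                  ≈⟨ toℚᵘ-/ (p N.+ q) d ⟨
    toℚᵘ (+ (p N.+ q) / d)               ∎)
    where
    open U.≃-Reasoning
    cross : (+ p Z.* + d Z.+ + q Z.* + d) Z.* + d ≡ + (p N.+ q) Z.* (+ d Z.* + d)
    cross = trans (cong (Z._* + d) (sym (Z.*-distribʳ-+ (+ d) (+ p) (+ q))))
      (Z.*-assoc (+ (p N.+ q)) (+ d) (+ d))

  /-^ : ∀ p d r .{{_ : NonZero d}} → (+ p / d) ^ℚ r ≡ _/_ (+ (p N.^ r)) (d N.^ r) {{N.m^n≢0 d r}}
  /-^ p d zero    = refl
  /-^ p d (suc r) {{d≢0}} = trans (cong ((+ p / d) *_) (/-^ p d r))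
    (/-* p (p N.^ r) d (d N.^ r) {{d≢0}} {{N.m^n≢0 d r}})

  ∣/∣ : ∀ p d .{{_ : NonZero d}} → ∣ + p / d ∣ ≡ + p / d
  ∣/∣ p d = 0≤p⇒∣p∣≡p (/-mono-≤ 0 p 1 d N.z≤n)

-- The error term and the final inequality.

module Epsilon where
  open Selections
  open import Data.Fin using (zero)
  open import Data.Product using (proj₁)
  open import Relation.Nullary using (¬_)
  open Binomials
  open Fractions
  open import Data.Integer using (+_)
  open import Data.Nat using (ℕ; zero; suc; NonZero)
  import Data.Nat as N
  import Data.Nat.Properties as N
  open import Data.Nat.Tactic.RingSolver using (solve-∀)
  open import Data.Rational hiding (NonZero)
  open import Data.Rational.Properties
  open import Relation.Binary.PropositionalEquality

  4*denominator≢0 : ∀ n .{{_ : NonZero n}} → NonZero (4 N.* denominator n)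
  4*denominator≢0 n = N.m*n≢0 4 _ {{_}} {{N.m*n≢0 (2 N.* n) _ {{N.m*n≢0 2 n}} {{N.m^n≢0 16 n}}}}

  -- ε 1 makes the claim trivial, as 0 and 1 are not distinct residues modulo 1.
  ε : ℕ → ℚ
  ε 0 = 0ℚ
  ε 1 = + 5 / 4
  ε n@(suc (suc _)) = _/_ (+ (5 N.* excess n)) (4 N.* denominator n) {{4*denominator≢0 n}}

  -- Squaring turns n^(3/2) into the integer n³, and θ² n ≤ 2 gives the constant 1. The range starts
  -- at 2, since `ε 1` has square 25/16.
  ε-bound : ∀ n → 2 N.≤ n → ∣ ε n ∣ * ∣ ε n ∣ * (+ (n N.* n N.* n) / 1) ≤ 1ℚ * 1ℚ
  ε-bound 1 (N.s≤s ())
  ε-bound n@(suc (suc _)) _ = subst (_≤ 1ℚ) (sym square)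
    (/-mono-≤ (a N.* a N.* (n N.* n N.* n)) 1 (d N.* d N.* 1) 1 {{dd1≢0}} (begin
      a N.* a N.* (n N.* n N.* n) N.* 1
        ≡⟨ expand (excess n) n ⟩
      25 N.* (n N.* n) N.* (excess n N.* excess n N.* n)
        ≤⟨ N.*-monoʳ-≤ (25 N.* (n N.* n)) (excess²*n≤2*256^n n) ⟩
      25 N.* (n N.* n) N.* (2 N.* (u N.* u))
        -- The coefficients compared are 25 · 2 = 50 and (4 · 2)² = 64, with difference 14.
        ≤⟨ N.m≤m+n _ (14 N.* (n N.* n N.* (u N.* u))) ⟩
      25 N.* (n N.* n) N.* (2 N.* (u N.* u)) N.+ 14 N.* (n N.* n N.* (u N.* u))
        ≡⟨ collect n u ⟩
      1 N.* (d N.* d N.* 1) ∎))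
    where
    open N.≤-Reasoning
    a = 5 N.* excess n
    d = 4 N.* denominator n
    u = 16 N.^ n
    d≢0 : NonZero d
    d≢0 = 4*denominator≢0 n
    dd≢0 : NonZero (d N.* d)
    dd≢0 = N.m*n≢0 d d {{d≢0}} {{d≢0}}
    dd1≢0 : NonZero (d N.* d N.* 1)
    dd1≢0 = N.m*n≢0 (d N.* d) 1 {{dd≢0}}
    square : ∣ ε n ∣ * ∣ ε n ∣ * (+ (n N.* n N.* n) / 1)
      ≡ _/_ (+ (a N.* a N.* (n N.* n N.* n))) (d N.* d N.* 1) {{dd1≢0}}
    square = trans (cong (_* (+ (n N.* n N.* n) / 1)) (trans
      (cong (λ x → x * x) (∣/∣ a d {{d≢0}})) (/-* a a d d {{d≢0}} {{d≢0}})))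
      (/-* (a N.* a) (n N.* n N.* n) (d N.* d) 1 {{dd≢0}})
    expand : ∀ e n → 5 N.* e N.* (5 N.* e) N.* (n N.* n N.* n) N.* 1 ≡ 25 N.* (n N.* n) N.* (e N.* e N.* n)
    expand = solve-∀
    collect : ∀ n u → 25 N.* (n N.* n) N.* (2 N.* (u N.* u)) N.+ 14 N.* (n N.* n N.* (u N.* u))
      ≡ 1 N.* (4 N.* (2 N.* n N.* u) N.* (4 N.* (2 N.* n N.* u)) N.* 1)
    collect = solve-∀

  -- Splitting 5/4 over the common denominator as a multiple of `numerator n` plus `ε n` lets the
  -- latter cancel.
  5/4-ε : ∀ n-2 → let n = suc (suc n-2) in
    (+ 5 / 4) - ε n ≡ _/_ (+ (5 N.* numerator n)) (4 N.* denominator n) {{4*denominator≢0 n}}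
  5/4-ε n-2 = begin
    (+ 5 / 4) - ε n
      ≡⟨ cong (_- ε n) (/-cross 5 (p N.+ a) 4 d cross) ⟩
    (+ (p N.+ a) / d) - ε n
      ≡⟨ cong (_- ε n) (/-+ p a d) ⟨
    (+ p / d) + ε n - ε n
      ≡⟨ +-assoc (+ p / d) (ε n) (- ε n) ⟩
    (+ p / d) + (ε n - ε n)
      ≡⟨ cong (λ x → (+ p / d) + x) (+-inverseʳ (ε n)) ⟩
    (+ p / d) + 0ℚ
      ≡⟨ +-identityʳ (+ p / d) ⟩
    + p / d ∎
    where
    open ≡-Reasoning
    n = suc (suc n-2)
    p = 5 N.* numerator n
    a = 5 N.* excess n
    d = 4 N.* denominator n
    instance
      d≢0 : NonZero d
      d≢0 = 4*denominator≢0 n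
    factor : ∀ x y → 5 N.* (4 N.* (x N.+ y)) ≡ (5 N.* x N.+ 5 N.* y) N.* 4
    factor = solve-∀
    cross : 5 N.* d ≡ (p N.+ a) N.* 4
    cross = trans (cong (λ x → 5 N.* (4 N.* x)) (sym (numerator+excess n))) (factor (numerator n) (excess n))

  -- The base 5/4 - `ε 1` is 0, so m = 0, and no index can be selected from the empty sequence.
  s-gt-1 : ∀ r → s-gt 2 1 (suc r) ((+ 1 / 2) * (((+ 5 / 4) - ε 1) ^ℚ suc r))
  s-gt-1 r m m≤ every = empty m m≤0 every
    where
    m≤0 : m N.≤ 0
    m≤0 = subst (N._≤ 0) (N.*-identityʳ m) (/-cancel-≤ m 0 1 1 (subst ((+ m / 1) ≤_)
      (trans (cong ((+ 1 / 2) *_) (*-zeroˡ (((+ 5 / 4) - ε 1) ^ℚ r))) (*-zeroʳ (+ 1 / 2))) m≤))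
    empty : ∀ m → m N.≤ 0 → ¬ EveryHasZS 2 1 (suc r) m
    empty zero N.z≤n every with proj₁ (every λ ()) zero
    ... | ()

  -- Clearing denominators in the bound on m gives `few`, the hypothesis of `union-bound-fails`,
  -- which contradicts `EveryHasZS⇒≤`.
  s-gt-2+ : ∀ n-2 r → let n = suc (suc n-2) in s-gt 2 n r ((+ n / 2) * (((+ 5 / 4) - ε n) ^ℚ r))
  s-gt-2+ n-2 r m m≤ every = N.<⇒≱ (union-bound-fails n m r few) (EveryHasZS⇒≤ n-2 r m every)
    where
    n = suc (suc n-2)
    p = 5 N.* numerator n
    d = 4 N.* denominator n
    instance
      d≢0 : NonZero d
      d≢0 = 4*denominator≢0 n
      d^r≢0 : NonZero (d N.^ r)
      d^r≢0 = N.m^n≢0 d r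
      2*d^r≢0 : NonZero (2 N.* d N.^ r)
      2*d^r≢0 = N.m*n≢0 2 (d N.^ r)
    bound : (+ n / 2) * (((+ 5 / 4) - ε n) ^ℚ r) ≡ + (n N.* p N.^ r) / (2 N.* d N.^ r)
    bound = trans (cong ((+ n / 2) *_) (trans (cong (_^ℚ r) (5/4-ε n-2)) (/-^ p d r)))
      (/-* n (p N.^ r) 2 (d N.^ r))
    rearrange : ∀ m x → 2 N.* m N.* x ≡ m N.* (2 N.* x)
    rearrange = solve-∀
    few : 2 N.* m N.* d N.^ r N.≤ n N.* p N.^ r
    few = subst₂ N._≤_ (sym (rearrange m (d N.^ r))) (N.*-identityʳ (n N.* p N.^ r))
      (/-cancel-≤ m (n N.* p N.^ r) 1 (2 N.* d N.^ r) (subst ((+ m / 1) ≤_) bound m≤))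

  s-gt-ε : ∀ n r → 0 N.< n → 0 N.< r → s-gt 2 n r ((+ n / 2) * (((+ 5 / 4) - ε n) ^ℚ r))
  s-gt-ε 1                 (suc r) _ _ = s-gt-1 r
  s-gt-ε (suc (suc n-2)) r       _ _ = s-gt-2+ n-2 r

open Epsilon using (ε; ε-bound; s-gt-ε)
open import Data.Nat using (ℕ)
import Data.Nat as N
open import Data.Integer using (+_)
open import Data.Rational using (ℚ; 1ℚ; _/_; _*_; _-_; _≤_; ∣_∣)

theorem1 : Σ (ℕ → ℚ) λ ε →
    (∃ λ (C : ℚ) → ∃ λ (M : ℕ) → ∀ (n : ℕ) → M N.≤ n →
       ∣ ε n ∣ * ∣ ε n ∣ * (+ (n N.* n N.* n) / 1) ≤ C * C)
    × (∀ (n r : ℕ) → 0 N.< n → 0 N.< r →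
         s-gt 2 n r ((+ n / 2) * (((+ 5 / 4) - ε n) ^ℚ r)))
theorem1 = ε , (1ℚ , 2 , ε-bound) , s-gt-ε
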